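{- Let $\alpha_i\ge 0$, $\beta_i>0$ ($1\le i\le 5$) and $Q>0$ be real numbers, and consider the networks $N$ and $N^+$ with these parameters and total flow $Q$. Suppose that at equilibria $N$ has no path with vanishing flow and $P_2$ is the only path with vanishing flow in $N^+$. Then Braess' paradox occurs in $N/N^+$ (i.e. $T^+_{Eq}>T_{Eq}$) if and only if $\mathcal B_4>0$ and $$\max\left\{\frac{\alpha}{\beta_{12}},\ \frac{ -\alpha}{\beta_{45}},\ \frac{\hat\alpha}{\beta_{35}},\ \frac{ -\hat\alpha}{\beta_2},\ \frac{\hat\alpha\beta_2\beta+\alpha\beta_{235}\beta_{12}}{\mathcal B_4}\right\} < Q \le \mu_2.$$
   Context: The network $N^+$ has nodes $a,b,c,d$ and directed links $(a,b),(b,d),(b,c),(a,c),(c,d)$ with travel times $\alpha_1+\beta_1f_{ab}$, $\alpha_2+\beta_2f_{bd}$, $\alpha_3+\beta_3f_{bc}$, $\alpha_4+\beta_4f_{ac}$, $\alpha_5+\beta_5f_{cd}$ respectively, where $f_{ij}\ge 0$ is the (real) flow on link $(i,j)$ and $\alpha_i\ge 0$, $\beta_i>0$. All traffic, of total amount $Q>0$ (real), goes from $a$ to $d$ along the paths $P_1=a-b-d$, $P_2=a-c-d$, $P_3=a-b-c-d$. The network $N$ is $N^+$ with the link $(b,c)$ removed, so its paths are $P_1,P_2$ only. A flow assigns a non-negative real amount to each path, with total $Q$; the flow on a link is the sum of the flows of the paths containing it; the travel time on a path is the sum of the travel times of its links. A path has vanishing flow if its path flow is $0$, and non-vanishing flow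 otherwise. A network is at equilibrium if all paths with non-vanishing flow have the same travel time, and every path with vanishing flow has travel time at least this common value. The equilibrium exists and is unique; its common travel time is denoted $T_{Eq}$ for $N$ and $T^+_{Eq}$ for $N^+$. Braess' paradox is said to occur in $N/N^+$ for the total flow $Q$ if $T^+_{Eq}>T_{Eq}$. Notation: multiple indices denote sums, e.g. $\alpha_{ij}=\alpha_i+\alpha_j$, $\beta_{235}=\beta_2+\beta_3+\beta_5$. Further, $\alpha=\alpha_{45}-\alpha_{12}$, $\bar\alpha=\alpha_4-\alpha_{13}$, $\hat\alpha=\alpha_2-\alpha_{35}$, $\beta=\beta_1+\beta_2+\beta_4+\beta_5$, $\mathcal B_4=\beta_{12}^2\beta_{235}-\beta_2^2\beta$, and $$\mu_2=\frac{\bar\alpha\beta_{25}+\alpha\beta_3}{\beta_1\beta_{25}+\beta_3\beta_{12}}.$$ -}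

module Defs where

open import Data.Fin.Base using (Fin)
open import Data.Fin.Patterns using (0F; 1F; 2F; 3F; 4F)
open import Data.Fin.Properties using () renaming (_≟_ to _≟ᶠ_)
open import Data.List.Base using (List; []; _∷_; foldr; map; tabulate)
open import Data.List.Membership.DecPropositional (_≟ᶠ_ {5}) using (_∈?_)
open import Data.Nat.Base as ℕ using (ℕ)
import Data.Nat.Properties as ℕ
open import Data.Product.Base using (∃-syntax; _×_; _,_; proj₁; proj₂)
open import Data.Rational.Base as ℚ using (ℚ; 0ℚ; 1ℚ)
import Data.Rational.Properties as ℚ
open import Data.Rational.Solver using (module +-*-Solver)
open import Data.Sum.Base using (_⊎_; inj₁; inj₂)
open import Data.Vec.Base using (Vec; []; _∷_; lookup)
open import Relation.Binary.PropositionalEquality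
  using (_≡_; _≢_; refl; sym; trans; cong; cong₂; subst; subst₂)
open import Relation.Nullary using (¬_; yes; no; does; contradiction)
open import Data.Bool.Base using (if_then_else_)

module Rational where
  open import Data.Rational.Base hiding (ℚ; 0ℚ; 1ℚ)
  open +-*-Solver

  dist : ℚ → ℚ → ℚ
  dist p q = ∣ p - q ∣

  *-pos : ∀ {p q} → 0ℚ < p → 0ℚ < q → 0ℚ < p * q
  *-pos {p} {q} 0<p 0<q = ℚ.positive⁻¹ (p * q)
    {{ℚ.pos*pos⇒pos p {{positive 0<p}} q {{positive 0<q}}}}

  +-pos : ∀ {p q} → 0ℚ < p → 0ℚ < q → 0ℚ < p + q
  +-pos 0<p 0<q = ℚ.+-mono-< 0<p 0<q

  *-mono-<-nonneg : ∀ {p q r s} → 0ℚ ≤ p → p < q → 0ℚ ≤ r → r < s →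
                    p * r < q * s
  *-mono-<-nonneg {p} {q} {r} {s} 0≤p p<q 0≤r r<s = ℚ.≤-<-trans
    (ℚ.*-monoˡ-≤-nonNeg p {{nonNegative 0≤p}} (ℚ.<⇒≤ r<s))
    (ℚ.*-monoˡ-<-pos s {{positive (ℚ.≤-<-trans 0≤r r<s)}} p<q)

  quotient : ∀ {b e} → 0ℚ < b → 0ℚ < e → ∃[ d ] 0ℚ < d × b * d ≡ e
  quotient {b} {e} 0<b 0<e = i * e , *-pos 0<i 0<e ,
    trans (sym (ℚ.*-assoc b i e))
      (trans (cong (_* e) (ℚ.*-inverseʳ b)) (ℚ.*-identityˡ e))
    where
    instance
      b-pos     = positive 0<b
      b-nonZero = ℚ.pos⇒nonZero b
    i   = 1/ b
    0<i = ℚ.positive⁻¹ i {{ℚ.1/pos⇒pos b}}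

  recip : ℚ → ℚ
  recip q with q ℚ.≟ 0ℚ
  ... | yes _   = 0ℚ
  ... | no  q≢0 = (1/ q) {{≢-nonZero q≢0}}

  recip-inverse : ∀ {q} → 0ℚ < q → q * recip q ≡ 1ℚ
  recip-inverse {q} 0<q with q ℚ.≟ 0ℚ
  ... | yes q≡0 = contradiction (sym q≡0) (ℚ.<⇒≢ 0<q)
  ... | no  q≢0 = ℚ.*-inverseʳ q {{≢-nonZero q≢0}}

  dist-+ : ∀ p q r s → dist (p + q) (r + s) ≤ dist p r + dist q s
  dist-+ p q r s = subst (λ t → ∣ t ∣ ≤ dist p r + dist q s)
    (solve 4 (λ p q r s → (p :- r) :+ (q :- s) := (p :+ q) :- (r :+ s))
      refl p q r s)
    (ℚ.∣p+q∣≤∣p∣+∣q∣ (p - r) (q - s))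

  dist-neg : ∀ p q → dist (- p) (- q) ≡ dist p q
  dist-neg p q = trans
    (cong ∣_∣ (solve 2 (λ p q → (:- p) :- (:- q) := :- (p :- q)) refl p q))
    (ℚ.∣-p∣≡∣p∣ (p - q))

  dist-* : ∀ p q r s → dist (p * q) (r * s) ≤ ∣ p ∣ * dist q s + ∣ s ∣ * dist p r
  dist-* p q r s = subst₂ _≤_
    (cong ∣_∣ (solve 4 (λ p q r s →
      p :* (q :- s) :+ s :* (p :- r) := p :* q :- r :* s) refl p q r s))
    (cong₂ _+_ (ℚ.∣p*q∣≡∣p∣*∣q∣ p (q - s)) (ℚ.∣p*q∣≡∣p∣*∣q∣ s (p - r)))
    (ℚ.∣p+q∣≤∣p∣+∣q∣ (p * (q - s)) (s * (p - r)))

  p≤∣p∣ : ∀ p → p ≤ ∣ p ∣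
  p≤∣p∣ p with ℚ.≤-total 0ℚ p
  ... | inj₁ 0≤p = ℚ.≤-reflexive (sym (ℚ.0≤p⇒∣p∣≡p 0≤p))
  ... | inj₂ p≤0 = ℚ.≤-trans p≤0 (ℚ.0≤∣p∣ p)

  dist-sym : ∀ p q → dist p q ≡ dist q p
  dist-sym p q = trans (sym (ℚ.∣-p∣≡∣p∣ (p - q)))
    (cong ∣_∣ (solve 2 (λ p q → :- (p :- q) := q :- p) refl p q))

  dist< : ∀ {p q e} → p < q + e → q < p + e → dist p q < e
  dist< {p} {q} {e} p<q+e q<p+e with ℚ.∣p∣≡p∨∣p∣≡-p (p - q)
  ... | inj₁ eq = subst₂ _<_
    (trans (solve 2 (λ p q → (:- q) :+ p := p :- q) refl p q) (sym eq))
    (solve 2 (λ q e → (:- q) :+ (q :+ e) := e) refl q e)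
    (ℚ.+-monoʳ-< (- q) p<q+e)
  ... | inj₂ eq = subst₂ _<_
    (trans (solve 2 (λ p q → (:- p) :+ q := :- (p :- q)) refl p q) (sym eq))
    (solve 2 (λ p e → (:- p) :+ (p :+ e) := e) refl p e)
    (ℚ.+-monoʳ-< (- p) q<p+e)

  dist<⇒<+ : ∀ {p q e} → dist p q < e → p < q + e
  dist<⇒<+ {p} {q} {e} d<e = subst (_< q + e)
    (solve 2 (λ p q → q :+ (p :- q) := p) refl p q)
    (ℚ.+-monoʳ-< q (ℚ.≤-<-trans (p≤∣p∣ (p - q)) d<e))

  ⊔-<+ : ∀ {p q r s e} → p < r + e → q < s + e → p ⊔ q < (r ⊔ s) + e
  ⊔-<+ {p} {q} {r} {s} {e} p<r+e q<s+e with ℚ.⊔-sel p q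
  ... | inj₁ eq = subst (_< (r ⊔ s) + e) (sym eq)
    (ℚ.<-≤-trans p<r+e (ℚ.+-monoˡ-≤ e (ℚ.p≤p⊔q r s)))
  ... | inj₂ eq = subst (_< (r ⊔ s) + e) (sym eq)
    (ℚ.<-≤-trans q<s+e (ℚ.+-monoˡ-≤ e (ℚ.p≤q⊔p r s)))

  dist-⊔ : ∀ {p q r s e} → dist p r < e → dist q s < e →
           dist (p ⊔ q) (r ⊔ s) < e
  dist-⊔ {p} {q} {r} {s} {e} pr qs = dist<
    (⊔-<+ {p} {q} {r} {s} (dist<⇒<+ {p} {r} pr) (dist<⇒<+ {q} {s} qs))
    (⊔-<+ {r} {s} {p} {q}
      (dist<⇒<+ {r} {p} (subst (_< e) (dist-sym p r) pr))
      (dist<⇒<+ {s} {q} (subst (_< e) (dist-sym q s) qs)))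

  dist-recip : ∀ {p q d e} → 0ℚ < d → 0ℚ < e → d ≤ p → d ≤ q →
               dist p q < e * (d * d) → dist (recip p) (recip q) < e
  dist-recip {p} {q} {d} {e} 0<d 0<e d≤p d≤q pq<edd =
    ℚ.*-cancelʳ-<-nonNeg (p * q) {{nonNegative (ℚ.<⇒≤ 0<pq)}}
      (ℚ.≤-<-trans (ℚ.≤-reflexive step) (ℚ.<-≤-trans pq<edd edd≤epq))
    where
    0<p  = ℚ.<-≤-trans 0<d d≤p
    0<q  = ℚ.<-≤-trans 0<d d≤q
    0<pq = *-pos 0<p 0<q

    edd≤epq : e * (d * d) ≤ e * (p * q)
    edd≤epq = ℚ.*-monoˡ-≤-nonNeg e {{nonNegative (ℚ.<⇒≤ 0<e)}} (ℚ.≤-trans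
      (ℚ.*-monoˡ-≤-nonNeg d {{nonNegative (ℚ.<⇒≤ 0<d)}} d≤q)
      (ℚ.*-monoʳ-≤-nonNeg q {{nonNegative (ℚ.<⇒≤ 0<q)}} d≤p))

    cancelled : (recip p - recip q) * (p * q) ≡ q - p
    cancelled = trans
      (solve 4 (λ p q i j → (i :- j) :* (p :* q) :=
                            (p :* i) :* q :- (q :* j) :* p)
        refl p q (recip p) (recip q))
      (cong₂ _-_
        (trans (cong (_* q) (recip-inverse 0<p)) (ℚ.*-identityˡ q))
        (trans (cong (_* p) (recip-inverse 0<q)) (ℚ.*-identityˡ p)))

    step : dist (recip p) (recip q) * (p * q) ≡ dist p q
    step = trans
      (cong (dist (recip p) (recip q) *_) (sym (ℚ.0≤p⇒∣p∣≡p (ℚ.<⇒≤ 0<pq))))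
      (trans (sym (ℚ.∣p*q∣≡∣p∣*∣q∣ (recip p - recip q) (p * q)))
      (trans (cong ∣_∣ cancelled) (dist-sym q p)))

open Rational

infix 4 _≈_ _<_ _≤_ _#_

IsCauchy : (ℕ → ℚ) → Set
IsCauchy s = ∀ ε → 0ℚ ℚ.< ε → ∃[ N ] ∀ {m n} → N ℕ.≤ m → N ℕ.≤ n →
             ℚ.∣ s m ℚ.- s n ∣ ℚ.< ε

record ℝ : Set where
  constructor mkℝ
  field
    seq    : ℕ → ℚ
    cauchy : IsCauchy seq

open ℝ public

record _≈_ (x y : ℝ) : Set where
  constructor mk≈
  field
    close : ∀ ε → 0ℚ ℚ.< ε → ∃[ N ] ∀ {n} → N ℕ.≤ n →
            ℚ.∣ seq x n ℚ.- seq y n ∣ ℚ.< ε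

record _<_ (x y : ℝ) : Set where
  constructor mk<
  field
    gap       : ℚ
    gap>0     : 0ℚ ℚ.< gap
    threshold : ℕ
    separated : ∀ {n} → threshold ℕ.≤ n → seq x n ℚ.+ gap ℚ.≤ seq y n

_≤_ : ℝ → ℝ → Set
x ≤ y = ¬ (y < x)

-- Apartness, the constructive reading of x ≠ y; classically the two agree.
_#_ : ℝ → ℝ → Set
x # y = x < y ⊎ y < x

≤⊔ˡ : ∀ {m n k} → m ℕ.⊔ n ℕ.≤ k → m ℕ.≤ k
≤⊔ˡ {m} {n} = ℕ.≤-trans (ℕ.m≤m⊔n m n)

≤⊔ʳ : ∀ {m n k} → m ℕ.⊔ n ℕ.≤ k → n ℕ.≤ k
≤⊔ʳ {m} {n} = ℕ.≤-trans (ℕ.m≤n⊔m m n)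

bound : ∀ x → ∃[ b ] 0ℚ ℚ.< b × ∃[ N ] ∀ {n} → N ℕ.≤ n → ℚ.∣ seq x n ∣ ℚ.< b
bound x = b , 0<b , N , bounded
  where
  N = proj₁ (cauchy x 1ℚ (ℚ.positive⁻¹ 1ℚ))
  c = seq x N
  b = ℚ.∣ c ∣ ℚ.+ 1ℚ

  0<b : 0ℚ ℚ.< b
  0<b = ℚ.+-mono-≤-< (ℚ.0≤∣p∣ c) (ℚ.positive⁻¹ 1ℚ)

  bounded : ∀ {n} → N ℕ.≤ n → ℚ.∣ seq x n ∣ ℚ.< b
  bounded {n} N≤n = ℚ.≤-<-trans
    (subst (λ t → ℚ.∣ t ∣ ℚ.≤ ℚ.∣ c ∣ ℚ.+ dist (seq x n) c)
      (solve 2 (λ c p → c :+ (p :- c) := p) refl c (seq x n))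
      (ℚ.∣p+q∣≤∣p∣+∣q∣ c (seq x n ℚ.- c)))
    (ℚ.+-monoʳ-< ℚ.∣ c ∣
      (proj₂ (cauchy x 1ℚ (ℚ.positive⁻¹ 1ℚ)) N≤n ℕ.≤-refl))
    where open +-*-Solver

0ℝ : ℝ
0ℝ = mkℝ (λ _ → 0ℚ) λ ε 0<ε → 0 , λ _ _ → 0<ε

private
  abstract
    +-cauchy : ∀ x y → IsCauchy (λ n → seq x n ℚ.+ seq y n)
    +-cauchy x y ε 0<ε =
      let δ , 0<δ , 2δ≡ε = quotient {1ℚ ℚ.+ 1ℚ} (ℚ.positive⁻¹ _) 0<ε
          M , x-close = cauchy x δ 0<δ
          N , y-close = cauchy y δ 0<δ
          δ+δ≡ε = trans (trans (cong₂ ℚ._+_ (sym (ℚ.*-identityˡ δ)) (sym (ℚ.*-identityˡ δ)))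
                               (sym (ℚ.*-distribʳ-+ δ 1ℚ 1ℚ))) 2δ≡ε
      in M ℕ.⊔ N , λ {m} {n} ≤m ≤n → ℚ.≤-<-trans
           (dist-+ (seq x m) (seq y m) (seq x n) (seq y n))
           (subst (_ ℚ.<_) δ+δ≡ε (ℚ.+-mono-<
             (x-close (≤⊔ˡ ≤m) (≤⊔ˡ ≤n)) (y-close (≤⊔ʳ {M} ≤m) (≤⊔ʳ {M} ≤n))))

    neg-cauchy : ∀ x → IsCauchy (λ n → ℚ.- seq x n)
    neg-cauchy x ε 0<ε =
      let N , close = cauchy x ε 0<ε
      in N , λ {m} {n} ≤m ≤n →
           subst (ℚ._< ε) (sym (dist-neg (seq x m) (seq x n))) (close ≤m ≤n)

    *-cauchy : ∀ x y → IsCauchy (λ n → seq x n ℚ.* seq y n)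
    *-cauchy x y ε 0<ε =
      let b , 0<b , K , x-bounded = bound x
          c , 0<c , L , y-bounded = bound y
          δ , 0<δ , [b+c]δ≡ε = quotient {b ℚ.+ c} (+-pos 0<b 0<c) 0<ε
          M , x-close = cauchy x δ 0<δ
          N , y-close = cauchy y δ 0<δ
          bδ+cδ≡ε = trans (sym (ℚ.*-distribʳ-+ δ b c)) [b+c]δ≡ε
      in (K ℕ.⊔ L) ℕ.⊔ (M ℕ.⊔ N) , λ {m} {n} ≤m ≤n →
           let K⊔L≤m = ≤⊔ˡ ≤m
               K⊔L≤n = ≤⊔ˡ ≤n
               M⊔N≤m = ≤⊔ʳ {K ℕ.⊔ L} ≤m
               M⊔N≤n = ≤⊔ʳ {K ℕ.⊔ L} ≤n
           in ℚ.≤-<-trans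
           (dist-* (seq x m) (seq y m) (seq x n) (seq y n))
           (subst (_ ℚ.<_) bδ+cδ≡ε (ℚ.+-mono-<
             (*-mono-<-nonneg (ℚ.0≤∣p∣ _) (x-bounded (≤⊔ˡ K⊔L≤m))
               (ℚ.0≤∣p∣ _) (y-close (≤⊔ʳ {M} M⊔N≤m) (≤⊔ʳ {M} M⊔N≤n)))
             (*-mono-<-nonneg (ℚ.0≤∣p∣ _) (y-bounded (≤⊔ʳ {K} K⊔L≤n))
               (ℚ.0≤∣p∣ _) (x-close (≤⊔ˡ M⊔N≤m) (≤⊔ˡ M⊔N≤n)))))

    ⊔-cauchy : ∀ x y → IsCauchy (λ n → seq x n ℚ.⊔ seq y n)
    ⊔-cauchy x y ε 0<ε =
      let M , x-close = cauchy x ε 0<ε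
          N , y-close = cauchy y ε 0<ε
      in M ℕ.⊔ N , λ {m} {n} ≤m ≤n →
           dist-⊔ {seq x m} {seq y m} {seq x n} {seq y n}
           (x-close (≤⊔ˡ ≤m) (≤⊔ˡ ≤n)) (y-close (≤⊔ʳ {M} ≤m) (≤⊔ʳ {M} ≤n))

    recip-cauchy : ∀ x → 0ℝ < x → IsCauchy (λ n → recip (seq x n))
    recip-cauchy x (mk< δ 0<δ M 0+δ≤x) ε 0<ε =
      let N , close = cauchy x (ε ℚ.* (δ ℚ.* δ)) (*-pos 0<ε (*-pos 0<δ 0<δ))
      in M ℕ.⊔ N , λ {m} {n} ≤m ≤n →
           dist-recip {seq x m} {seq x n} 0<δ 0<ε
           (δ≤x (≤⊔ˡ ≤m)) (δ≤x (≤⊔ˡ ≤n)) (close (≤⊔ʳ {M} ≤m) (≤⊔ʳ {M} ≤n))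
      where
      δ≤x : ∀ {n} → M ℕ.≤ n → δ ℚ.≤ seq x n
      δ≤x M≤n = subst (ℚ._≤ _) (ℚ.+-identityˡ δ) (0+δ≤x M≤n)

infixl 6 _+_ _-_ _⊔_
infixl 7 _*_
infix  8 -_

_+_ : ℝ → ℝ → ℝ
x + y = mkℝ (λ n → seq x n ℚ.+ seq y n) (+-cauchy x y)

-_ : ℝ → ℝ
- x = mkℝ (λ n → ℚ.- seq x n) (neg-cauchy x)

_-_ : ℝ → ℝ → ℝ
x - y = x + (- y)

_*_ : ℝ → ℝ → ℝ
x * y = mkℝ (λ n → seq x n ℚ.* seq y n) (*-cauchy x y)

_⊔_ : ℝ → ℝ → ℝ
x ⊔ y = mkℝ (λ n → seq x n ℚ.⊔ seq y n) (⊔-cauchy x y)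

-- Positivity of x makes all but finitely many terms nonzero; recip sends a
-- zero term to 0.
inverse : (x : ℝ) → 0ℝ < x → ℝ
inverse x x>0 = mkℝ (λ n → recip (seq x n)) (recip-cauchy x x>0)

infixl 7 _/_[_]

_/_[_] : (x y : ℝ) → 0ℝ < y → ℝ
x / y [ y>0 ] = x * inverse y y>0

abstract
  +-positive : ∀ {x y} → 0ℝ < x → 0ℝ < y → 0ℝ < x + y
  +-positive {x} {y} (mk< δ 0<δ M δ≤x) (mk< ε 0<ε N ε≤y) =
    mk< (δ ℚ.+ ε) (+-pos 0<δ 0<ε) (M ℕ.⊔ N) λ {n} ≤n →
      subst (ℚ._≤ seq x n ℚ.+ seq y n)
        (solve 2 (λ d e → (con 0ℚ :+ d) :+ (con 0ℚ :+ e) := con 0ℚ :+ (d :+ e))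
          refl δ ε)
        (ℚ.+-mono-≤ (δ≤x (≤⊔ˡ ≤n)) (ε≤y (≤⊔ʳ {M} ≤n)))
    where open +-*-Solver

  *-positive : ∀ {x y} → 0ℝ < x → 0ℝ < y → 0ℝ < x * y
  *-positive {x} {y} (mk< δ 0<δ M δ≤x) (mk< ε 0<ε N ε≤y) =
    mk< (δ ℚ.* ε) (*-pos 0<δ 0<ε) (M ℕ.⊔ N) λ {n} ≤n →
      let δ≤xₙ = subst (ℚ._≤ seq x n) (ℚ.+-identityˡ δ) (δ≤x (≤⊔ˡ ≤n))
          ε≤yₙ = subst (ℚ._≤ seq y n) (ℚ.+-identityˡ ε) (ε≤y (≤⊔ʳ {M} ≤n))
          0≤yₙ = ℚ.≤-trans (ℚ.<⇒≤ 0<ε) ε≤yₙ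
      in subst (ℚ._≤ seq x n ℚ.* seq y n) (sym (ℚ.+-identityˡ (δ ℚ.* ε)))
        (ℚ.≤-trans
          (ℚ.*-monoˡ-≤-nonNeg δ {{ℚ.nonNegative (ℚ.<⇒≤ 0<δ)}} ε≤yₙ)
          (ℚ.*-monoʳ-≤-nonNeg (seq y n) {{ℚ.nonNegative 0≤yₙ}} δ≤xₙ))

sum : List ℝ → ℝ
sum = foldr _+_ 0ℝ

-- Link i carries the coefficients αᵢ₊₁ and βᵢ₊₁.
Link : Set
Link = Fin 5

pattern ab = 0F
pattern bd = 1F
pattern bc = 2F
pattern ac = 3F
pattern cd = 4F

-- A network is given by its paths, each the list of its links.
Network : ℕ → Set
Network n = Vec (List Link) n

pattern P₁ = 0F
pattern P₂ = 1F
pattern P₃ = 2F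

N : Network 2
N = (ab ∷ bd ∷ []) ∷ (ac ∷ cd ∷ []) ∷ []

N⁺ : Network 3
N⁺ = (ab ∷ bd ∷ []) ∷ (ac ∷ cd ∷ []) ∷ (ab ∷ bc ∷ cd ∷ []) ∷ []

record Parameters : Set where
  field
    α   : Link → ℝ
    β   : Link → ℝ
    α≥0 : ∀ i → 0ℝ ≤ α i
    β>0 : ∀ i → 0ℝ < β i

record Flow (n : ℕ) (Q : ℝ) : Set where
  field
    amount      : Fin n → ℝ
    nonNegative : ∀ p → 0ℝ ≤ amount p
    total       : sum (tabulate amount) ≈ Q

open Flow public

module _ {n : ℕ} {Q : ℝ} (f : Flow n Q) where

  Vanishing : Fin n → Set
  Vanishing p = amount f p ≈ 0ℝ

  NonVanishing : Fin n → Set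
  NonVanishing p = amount f p # 0ℝ

  OnlyVanishing : Fin n → Set
  OnlyVanishing p = Vanishing p × (∀ q → q ≢ p → NonVanishing q)

module _ (π : Parameters) {n : ℕ} (net : Network n) {Q : ℝ} (f : Flow n Q) where
  open Parameters π

  linkFlow : Link → ℝ
  linkFlow i = sum (tabulate λ p →
    if does (i ∈? lookup net p) then amount f p else 0ℝ)

  linkTime : Link → ℝ
  linkTime i = α i + β i * linkFlow i

  travelTime : Fin n → ℝ
  travelTime p = sum (map linkTime (lookup net p))

-- If Q > 0 then some path has non-vanishing flow, so the flow determines time.
record Equilibrium (π : Parameters) {n : ℕ} (net : Network n) (Q : ℝ) : Set where
  field
    flow         : Flow n Q
    time         : ℝ
    nonVanishing : ∀ p → NonVanishing flow p → travelTime π net flow p ≈ time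
    vanishing    : ∀ p → Vanishing flow p → time ≤ travelTime π net flow p

open Equilibrium public

BraessParadox : ∀ {π Q} → Equilibrium π N Q → Equilibrium π N⁺ Q → Set
BraessParadox e e⁺ = time e < time e⁺

module Quantities (π : Parameters) where
  open Parameters π public using () renaming (α to αᵢ; β to βᵢ; β>0 to βᵢ>0)

  α₁ α₂ α₃ α₄ α₅ β₁ β₂ β₃ β₄ β₅ : ℝ
  α₁ = αᵢ 0F
  α₂ = αᵢ 1F
  α₃ = αᵢ 2F
  α₄ = αᵢ 3F
  α₅ = αᵢ 4F
  β₁ = βᵢ 0F
  β₂ = βᵢ 1F
  β₃ = βᵢ 2F
  β₄ = βᵢ 3F
  β₅ = βᵢ 4F

  α ᾱ α̂ : ℝ
  α = (α₄ + α₅) - (α₁ + α₂)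
  ᾱ = α₄ - (α₁ + α₃)
  α̂ = α₂ - (α₃ + α₅)

  β₁₂ β₂₅ β₃₅ β₄₅ β₂₃₅ β : ℝ
  β₁₂  = β₁ + β₂
  β₂₅  = β₂ + β₅
  β₃₅  = β₃ + β₅
  β₄₅  = β₄ + β₅
  β₂₃₅ = β₂ + β₃ + β₅
  β    = β₁ + β₂ + β₄ + β₅

  ℬ₄ : ℝ
  ℬ₄ = β₁₂ * β₁₂ * β₂₃₅ - β₂ * β₂ * β

  β₂>0 : 0ℝ < β₂
  β₂>0 = βᵢ>0 1F

  β₁₂>0 : 0ℝ < β₁₂
  β₁₂>0 = +-positive (βᵢ>0 0F) (βᵢ>0 1F)

  β₂₅>0 : 0ℝ < β₂₅
  β₂₅>0 = +-positive (βᵢ>0 1F) (βᵢ>0 4F)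

  β₃₅>0 : 0ℝ < β₃₅
  β₃₅>0 = +-positive (βᵢ>0 2F) (βᵢ>0 4F)

  β₄₅>0 : 0ℝ < β₄₅
  β₄₅>0 = +-positive (βᵢ>0 3F) (βᵢ>0 4F)

  denominator>0 : 0ℝ < β₁ * β₂₅ + β₃ * β₁₂
  denominator>0 = +-positive (*-positive (βᵢ>0 0F) β₂₅>0) (*-positive (βᵢ>0 2F) β₁₂>0)

  μ₂ : ℝ
  μ₂ = (ᾱ * β₂₅ + α * β₃) / (β₁ * β₂₅ + β₃ * β₁₂) [ denominator>0 ]

{-# OPTIONS --safe #-}

-- Write x₁, x₂ > 0 for the equilibrium flows in N and y₁, y₃ > 0 (y₂ = 0) for
-- those in N⁺.  Equating travel times gives βx₁, βx₂, β₂₃₅y₁, β₂₃₅y₃ as affine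
-- functions of Q, so positivity of the flows is the first four lower bounds,
-- while T⁺ ≤ travel time of P₂ is Q ≤ μ₂.  Moreover
-- ββ₂₃₅(T⁺ − T) = Qℬ₄ − (α̂β₂β + αβ₂₃₅β₁₂), which is the fifth bound once ℬ₄ > 0.
-- Finally a paradox forces β₁₂β₅ > β₂β₄₅, and ℬ₄ is β₁₂(β₁₂β₅ − β₂β₄₅) plus
-- positive terms.
module Submission where

open import Data.Fin.Patterns using (0F; 1F; 2F; 3F; 4F)
open import Data.Nat.Base as ℕ using ()
import Data.Nat.Properties as ℕ
open import Data.Product.Base using (Σ; ∃-syntax; _×_; _,_; proj₁; proj₂)
open import Data.Rational.Base as ℚ using (0ℚ; 1ℚ)
import Data.Rational.Properties as ℚ
open import Data.Rational.Solver using (module +-*-Solver)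
open import Data.Sum.Base using (_⊎_; inj₁; inj₂)
open import Function.Bundles using (_⇔_; mk⇔)
open import Relation.Binary.PropositionalEquality
  using (_≡_; refl; sym; trans; cong; cong₂; subst; subst₂)
open import Relation.Nullary using (contradiction)
open import Defs
open Rational
open +-*-Solver

-- Rational estimates and equality of Cauchy reals.

abstract
  half : ∀ {ε} → 0ℚ ℚ.< ε → ∃[ δ ] 0ℚ ℚ.< δ × δ ℚ.+ δ ≡ ε
  half 0<ε =
    let δ , 0<δ , 2δ≡ε = quotient {1ℚ ℚ.+ 1ℚ} (ℚ.positive⁻¹ _) 0<ε
    in δ , 0<δ , trans (solve 1 (λ d → d :+ d := con (1ℚ ℚ.+ 1ℚ) :* d) refl δ) 2δ≡ε

∣p-q∣<ε⇒q<p+ε : ∀ {p q ε} → ℚ.∣ p ℚ.- q ∣ ℚ.< ε → q ℚ.< p ℚ.+ ε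
∣p-q∣<ε⇒q<p+ε {p} {q} {ε} d<ε = dist<⇒<+ {q} {p} (subst (ℚ._< ε) (dist-sym p q) d<ε)

+-cancelʳ-≤ : ∀ r {p q} → p ℚ.+ r ℚ.≤ q ℚ.+ r → p ℚ.≤ q
+-cancelʳ-≤ r {p} {q} le = subst₂ ℚ._≤_ (e p) (e q) (ℚ.+-monoˡ-≤ (ℚ.- r) le)
  where
  e : ∀ p → (p ℚ.+ r) ℚ.- r ≡ p
  e p = solve 2 (λ p r → (p :+ r) :- r := p) refl p r

-- Ring identities between reals are checked term by term, where `solve` settles them over ℚ. An
-- equation is thus derived by adding multiples of known equations into one `x ≈ y` and matching the
-- differences of the two sides.
≈-combination : ∀ {x y u v} → x ≈ y →
  (∀ n → seq u n ℚ.- seq v n ≡ seq x n ℚ.- seq y n) → u ≈ v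
≈-combination (mk≈ close) eq = mk≈ λ ε 0<ε →
  let M , near = close ε 0<ε
  in M , λ {n} M≤n → subst (λ t → ℚ.∣ t ∣ ℚ.< ε) (sym (eq n)) (near M≤n)

eventually-≡⇒≈ : ∀ {x y} M → (∀ {n} → M ℕ.≤ n → seq x n ≡ seq y n) → x ≈ y
eventually-≡⇒≈ {x} {y} M eq = mk≈ λ ε 0<ε → M , λ {n} M≤n →
  subst (λ t → ℚ.∣ t ∣ ℚ.< ε)
    (sym (trans (cong (ℚ._- seq y n) (eq M≤n)) (ℚ.+-inverseʳ (seq y n)))) 0<ε

≈-sym : ∀ {x y} → x ≈ y → y ≈ x
≈-sym {x} {y} (mk≈ close) = mk≈ λ ε 0<ε →
  let M , near = close ε 0<ε
  in M , λ {n} M≤n → subst (ℚ._< ε) (dist-sym (seq x n) (seq y n)) (near M≤n)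

infixl 6 _+-cong_

_+-cong_ : ∀ {x y u v} → x ≈ y → u ≈ v → x + u ≈ y + v
_+-cong_ {x} {y} {u} {v} (mk≈ xy) (mk≈ uv) = mk≈ λ ε 0<ε →
  let δ , 0<δ , δ+δ≡ε = half 0<ε
      L , near₁ = xy δ 0<δ
      M , near₂ = uv δ 0<δ
  in L ℕ.⊔ M , λ {n} ≤n → ℚ.≤-<-trans
       (dist-+ (seq x n) (seq u n) (seq y n) (seq v n))
       (subst (_ ℚ.<_) δ+δ≡ε (ℚ.+-mono-< (near₁ (≤⊔ˡ ≤n)) (near₂ (≤⊔ʳ {L} ≤n))))

*-congˡ : ∀ k {x y} → x ≈ y → k * x ≈ k * y
*-congˡ k {x} {y} (mk≈ xy) = mk≈ λ ε 0<ε →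
  let b , 0<b , L , bounded = bound k
      δ , 0<δ , bδ≡ε        = quotient 0<b 0<ε
      M , near              = xy δ 0<δ
  in L ℕ.⊔ M , λ {n} ≤n → subst₂ ℚ._<_
       (trans (sym (ℚ.∣p*q∣≡∣p∣*∣q∣ (seq k n) (seq x n ℚ.- seq y n)))
         (cong ℚ.∣_∣ (solve 3 (λ k x y → k :* (x :- y) := k :* x :- k :* y)
           refl (seq k n) (seq x n) (seq y n))))
       bδ≡ε
       (*-mono-<-nonneg (ℚ.0≤∣p∣ _) (bounded (≤⊔ˡ ≤n))
         (ℚ.0≤∣p∣ _) (near (≤⊔ʳ {L} ≤n)))

-- The strict order of the reals.

-- Counterpart of `≈-combination` for strict inequalities. One half of the gap of `a < b` absorbs
-- the error in `x ≈ y`; the other half separates `c` from `d`.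
<-combination : ∀ {a b x y c d} → a < b → x ≈ y →
  (∀ n → seq d n ℚ.- seq c n ≡ (seq b n ℚ.- seq a n) ℚ.+ (seq x n ℚ.- seq y n)) →
  c < d
<-combination {a} {b} {x} {y} {c} {d} (mk< γ 0<γ L a+γ≤b) (mk≈ xy) eq =
  let δ , 0<δ , δ+δ≡γ = half 0<γ
      M , near        = xy δ 0<δ
  in mk< δ 0<δ (L ℕ.⊔ M) λ {n} ≤n →
       -- Adding `a + δ + y` on both sides clears the subtractions and leaves the sum of `a + γ ≤ b`
       -- and `y ≤ x + δ`.
       +-cancelʳ-≤ (seq a n ℚ.+ δ ℚ.+ seq y n) (subst₂ ℚ._≤_
         (trans
           (cong (λ g → (seq a n ℚ.+ g ℚ.+ seq y n) ℚ.+ seq c n) (sym δ+δ≡γ))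
           (solve 4 (λ a g y c →
             (a :+ (g :+ g) :+ y) :+ c := (c :+ g) :+ (a :+ g :+ y))
             refl (seq a n) δ (seq y n) (seq c n)))
         (trans
           (solve 6 (λ a b x y c g → (b :+ (x :+ g)) :+ c :=
             ((b :- a) :+ (x :- y)) :+ (c :+ (a :+ g :+ y)))
             refl (seq a n) (seq b n) (seq x n) (seq y n) (seq c n) δ)
         (trans
           (cong (ℚ._+ (seq c n ℚ.+ (seq a n ℚ.+ δ ℚ.+ seq y n))) (sym (eq n)))
           (solve 3 (λ d c r → (d :- c) :+ (c :+ r) := d :+ r)
             refl (seq d n) (seq c n) (seq a n ℚ.+ δ ℚ.+ seq y n))))
         (ℚ.+-monoˡ-≤ (seq c n) (ℚ.+-mono-≤ (a+γ≤b (≤⊔ˡ ≤n))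
           (ℚ.<⇒≤ (∣p-q∣<ε⇒q<p+ε {seq x n} {seq y n} (near (≤⊔ʳ {L} ≤n)))))))

<-resp-difference : ∀ {a b c d} → a < b →
  (∀ n → seq d n ℚ.- seq c n ≡ seq b n ℚ.- seq a n) → c < d
<-resp-difference a<b eq = <-combination a<b (eventually-≡⇒≈ {0ℝ} {0ℝ} 0 λ _ → refl)
  λ n → trans (eq n) (sym (ℚ.+-identityʳ _))

x<y⇒0<y-x : ∀ {x y} → x < y → 0ℝ < y - x
x<y⇒0<y-x x<y = <-resp-difference x<y λ n → ℚ.+-identityʳ _

0<y-x⇒x<y : ∀ {x y} → 0ℝ < y - x → x < y
0<y-x⇒x<y 0<y-x = <-resp-difference 0<y-x λ n → sym (ℚ.+-identityʳ _)

nonneg∧#0⇒pos : ∀ {x} → 0ℝ ≤ x → x # 0ℝ → 0ℝ < x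
nonneg∧#0⇒pos 0≤x (inj₁ x<0) = contradiction x<0 0≤x
nonneg∧#0⇒pos 0≤x (inj₂ 0<x) = 0<x

-- Here and in `gap-above`, `d` approximates `y - x` with error below `η`; if `d` is at least `2η`,
-- then `y - x` exceeds `η`.
gap-below : ∀ {x y d η} → η ℚ.+ η ℚ.≤ d → ℚ.∣ d ℚ.- (y ℚ.- x) ∣ ℚ.< η → x ℚ.+ η ℚ.≤ y
gap-below {x} {y} {d} {η} 2η≤d near = +-cancelʳ-≤ η (subst₂ ℚ._≤_
  (solve 2 (λ x g → (g :+ g) :+ x := (x :+ g) :+ g) refl x η)
  (solve 3 (λ x y g → ((y :- x) :+ g) :+ x := y :+ g) refl x y η)
  (ℚ.+-monoˡ-≤ x (ℚ.≤-trans 2η≤d (ℚ.<⇒≤ (dist<⇒<+ {d} near)))))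

-- `y - x` stays below `3η`, while `z - x` is at least `4η`.
gap-above : ∀ {x y z d η} → d ℚ.≤ η ℚ.+ η → ℚ.∣ d ℚ.- (y ℚ.- x) ∣ ℚ.< η →
            x ℚ.+ ((η ℚ.+ η) ℚ.+ (η ℚ.+ η)) ℚ.≤ z → y ℚ.+ η ℚ.≤ z
gap-above {x} {y} {z} {d} {η} d≤2η near x+4η≤z = ℚ.≤-trans
  (subst₂ ℚ._≤_
    (solve 3 (λ x y g → (y :- x) :+ (x :+ g) := y :+ g) refl x y η)
    (solve 2 (λ x g → ((g :+ g) :+ g) :+ (x :+ g) := x :+ ((g :+ g) :+ (g :+ g)))
      refl x η)
    (ℚ.+-monoˡ-≤ (x ℚ.+ η) (ℚ.≤-trans
      (ℚ.<⇒≤ (∣p-q∣<ε⇒q<p+ε {d} near))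
      (ℚ.+-monoˡ-≤ η d≤2η))))
  x+4η≤z

-- The order on reals is not decided by cases. Instead `y - x` is approximated at one index `M` up
-- to `η = γ / 4`, and this rational is compared with `2η`, half of the gap. Since `≤` is the
-- negation of the reversed `<`, transitivity of `<` with `≤` rests on this.
<-cotrans : ∀ {x z} → x < z → ∀ y → x < y ⊎ y < z
<-cotrans {x} {z} (mk< γ 0<γ L x+γ≤z) y =
  let δ , 0<δ , δ+δ≡γ = half 0<γ
      η , 0<η , η+η≡δ = half 0<δ
      M , near        = cauchy (y - x) η 0<η
      4η≡γ            = trans (cong₂ ℚ._+_ η+η≡δ η+η≡δ) δ+δ≡γ
  in compare M η 0<η near 4η≡γ (ℚ.≤-total (η ℚ.+ η) (seq (y - x) M))
  where
  compare : ∀ M η → 0ℚ ℚ.< η →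
    (∀ {m n} → M ℕ.≤ m → M ℕ.≤ n → ℚ.∣ seq (y - x) m ℚ.- seq (y - x) n ∣ ℚ.< η) →
    (η ℚ.+ η) ℚ.+ (η ℚ.+ η) ≡ γ →
    η ℚ.+ η ℚ.≤ seq (y - x) M ⊎ seq (y - x) M ℚ.≤ η ℚ.+ η → x < y ⊎ y < z
  compare M η 0<η near 4η≡γ (inj₁ 2η≤d) = inj₁ (mk< η 0<η M λ {n} M≤n →
    gap-below {seq x n} {seq y n} {seq (y - x) M} 2η≤d (near ℕ.≤-refl M≤n))
  compare M η 0<η near 4η≡γ (inj₂ d≤2η) = inj₂ (mk< η 0<η (L ℕ.⊔ M) λ {n} ≤n →
    gap-above {seq x n} {seq y n} {seq z n} {seq (y - x) M} d≤2η (near ℕ.≤-refl (≤⊔ʳ {L} ≤n))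
      (subst (λ g → seq x n ℚ.+ g ℚ.≤ seq z n) (sym 4η≡γ) (x+γ≤z (≤⊔ˡ ≤n))))

<-≤-trans : ∀ {x y z} → x < y → y ≤ z → x < z
<-≤-trans {z = z} x<y y≤z with <-cotrans x<y z
... | inj₁ x<z = x<z
... | inj₂ z<y = contradiction z<y y≤z

-- The gap for `y` is `d = δ / b` with `b` an eventual bound of `x`: then `x d ≤ b d = δ ≤ x y`, and
-- the positive term of `x` cancels.
0<x∧0<xy⇒0<y : ∀ {x y} → 0ℝ < x → 0ℝ < x * y → 0ℝ < y
0<x∧0<xy⇒0<y {x} {y} (mk< γ 0<γ L γ≤x) (mk< δ 0<δ M δ≤xy) =
  let b , 0<b , K , bounded = bound x
      d , 0<d , bd≡δ        = quotient 0<b 0<δ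
  in mk< d 0<d (L ℕ.⊔ (M ℕ.⊔ K)) λ {n} ≤n →
       let M⊔K≤n = ≤⊔ʳ {L} ≤n
           0<xₙ  = ℚ.<-≤-trans (subst (0ℚ ℚ.<_) (sym (ℚ.+-identityˡ γ)) 0<γ)
                     (γ≤x (≤⊔ˡ ≤n))
           xₙ≤b  = ℚ.<⇒≤ (ℚ.≤-<-trans (p≤∣p∣ (seq x n)) (bounded (≤⊔ʳ {M} M⊔K≤n)))
       in subst (ℚ._≤ seq y n) (sym (ℚ.+-identityˡ d))
            (ℚ.*-cancelˡ-≤-pos (seq x n) {{ℚ.positive 0<xₙ}} (ℚ.≤-trans
              (ℚ.*-monoʳ-≤-nonNeg d {{ℚ.nonNegative (ℚ.<⇒≤ 0<d)}} xₙ≤b)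
              (subst (ℚ._≤ seq x n ℚ.* seq y n)
                (trans (ℚ.+-identityˡ δ) (sym bd≡δ))
                (δ≤xy (≤⊔ˡ M⊔K≤n)))))

-- Quotients and maxima in strict inequalities.

/-* : ∀ x {y} (y>0 : 0ℝ < y) → (x / y [ y>0 ]) * y ≈ x
-- From index `L` on the terms of `y` are positive; an earlier term may be zero, and `recip` then
-- returns 0.
/-* x {y} (mk< γ 0<γ L γ≤y) = eventually-≡⇒≈ L λ {n} L≤n →
  let 0<yₙ = ℚ.<-≤-trans (subst (0ℚ ℚ.<_) (sym (ℚ.+-identityˡ γ)) 0<γ) (γ≤y L≤n)
  in trans (solve 3 (λ x y r → (x :* r) :* y := x :* (y :* r))
             refl (seq x n) (seq y n) (recip (seq y n)))
     (trans (cong (seq x n ℚ.*_) (recip-inverse 0<yₙ)) (ℚ.*-identityʳ (seq x n)))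

/<⇒<* : ∀ {x y z} (y>0 : 0ℝ < y) → x / y [ y>0 ] < z → x < z * y
/<⇒<* {x} {y} {z} y>0 x/y<z = <-combination
  (*-positive y>0 (x<y⇒0<y-x x/y<z))
  (/-* x y>0)
  λ n → solve 4 (λ x y z r → z :* y :- x := (y :* (z :- r) :- con 0ℚ) :+ (r :* y :- x))
    refl (seq x n) (seq y n) (seq z n) (seq (x / y [ y>0 ]) n)

<*⇒/< : ∀ {x y z} (y>0 : 0ℝ < y) → x < z * y → x / y [ y>0 ] < z
<*⇒/< {x} {y} {z} y>0 x<zy = 0<y-x⇒x<y
  (0<x∧0<xy⇒0<y {y} {z - x / y [ y>0 ]} y>0
    (<-combination x<zy (≈-sym (/-* x y>0))
      λ n → solve 4 (λ x y z r → y :* (z :- r) :- con 0ℚ := (z :* y :- x) :+ (x :- r :* y))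
        refl (seq x n) (seq y n) (seq z n) (seq (x / y [ y>0 ]) n)))

⊔-<⁺ : ∀ {x y z} → x < z → y < z → x ⊔ y < z
⊔-<⁺ {x} {y} {z} (mk< γ 0<γ L x+γ≤z) (mk< δ 0<δ M y+δ≤z) = go (ℚ.≤-total γ δ)
  where
  least : ∀ η → 0ℚ ℚ.< η → η ℚ.≤ γ → η ℚ.≤ δ → x ⊔ y < z
  least η 0<η η≤γ η≤δ = mk< η 0<η (L ℕ.⊔ M) λ {n} ≤n →
    let x+η≤z = ℚ.≤-trans (ℚ.+-monoʳ-≤ (seq x n) η≤γ) (x+γ≤z (≤⊔ˡ ≤n))
        y+η≤z = ℚ.≤-trans (ℚ.+-monoʳ-≤ (seq y n) η≤δ) (y+δ≤z (≤⊔ʳ {L} ≤n))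
    in subst (ℚ._≤ seq z n)
         (sym (ℚ.mono-≤-distrib-⊔ (ℚ.+-monoˡ-≤ η) (seq x n) (seq y n)))
         (ℚ.⊔-lub x+η≤z y+η≤z)

  go : γ ℚ.≤ δ ⊎ δ ℚ.≤ γ → x ⊔ y < z
  go (inj₁ γ≤δ) = least γ 0<γ ℚ.≤-refl γ≤δ
  go (inj₂ δ≤γ) = least δ 0<δ δ≤γ ℚ.≤-refl

⊔-<⁻ʳ : ∀ {x y z} → x ⊔ y < z → y < z
⊔-<⁻ʳ {x} {y} (mk< γ 0<γ L x⊔y+γ≤z) = mk< γ 0<γ L λ {n} L≤n → ℚ.≤-trans
  (ℚ.+-monoˡ-≤ γ (ℚ.p≤q⊔p (seq x n) (seq y n))) (x⊔y+γ≤z L≤n)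

-- Turns a formula `k * w ≈ u` for a positive flow `w` into a bound on `Q`: `u` inherits positivity
-- and is the difference of the two sides of the bound.
positive⇒< : ∀ {k w u x y} → 0ℝ < k → 0ℝ < w → k * w ≈ u →
  (∀ n → seq y n ℚ.- seq x n ≡ seq u n) → x < y
positive⇒< {k} {w} {u} k>0 w>0 kw≈u eq = <-combination (*-positive k>0 w>0) (≈-sym kw≈u) λ n →
  trans (eq n) (solve 2 (λ u p → u := (p :- con 0ℚ) :+ (u :- p))
    refl (seq u n) (seq (k * w) n))

module _ (π : Parameters) (Q : ℝ) where
  open Quantities π

  -- Equilibrium of `N` with both paths in use.

  module Original (e : Equilibrium π N Q) (used : ∀ p → NonVanishing (flow e) p) where
    x₁ = amount (flow e) P₁
    x₂ = amount (flow e) P₂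

    x₁>0 : 0ℝ < x₁
    x₁>0 = nonneg∧#0⇒pos (nonNegative (flow e) P₁) (used P₁)

    x₂>0 : 0ℝ < x₂
    x₂>0 = nonneg∧#0⇒pos (nonNegative (flow e) P₂) (used P₂)

    x₁+x₂ : x₁ + x₂ ≈ Q
    x₁+x₂ = ≈-combination (total (flow e)) λ n →
      solve 3 (λ x y q → (x :+ y) :- q := (x :+ (y :+ con 0ℚ)) :- q)
        refl (seq x₁ n) (seq x₂ n) (seq Q n)

    time-P₁ : (α₁ + α₂) + β₁₂ * x₁ ≈ time e
    time-P₁ = ≈-combination (nonVanishing e P₁ (used P₁)) λ n →
      -- The right side is the unfolded `travelTime`; each `con 0ℚ` comes from a path that avoids
      -- the link or from the end of a `sum`.
      solve 6 (λ a₁ a₂ b₁ b₂ x t →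
        ((a₁ :+ a₂) :+ (b₁ :+ b₂) :* x) :- t :=
        ((a₁ :+ b₁ :* (x :+ con 0ℚ)) :+ ((a₂ :+ b₂ :* (x :+ con 0ℚ)) :+ con 0ℚ)) :- t)
        refl (seq α₁ n) (seq α₂ n) (seq β₁ n) (seq β₂ n) (seq x₁ n) (seq (time e) n)

    time-P₂ : (α₄ + α₅) + β₄₅ * x₂ ≈ time e
    time-P₂ = ≈-combination (nonVanishing e P₂ (used P₂)) λ n →
      solve 6 (λ a₄ a₅ b₄ b₅ x t →
        ((a₄ :+ a₅) :+ (b₄ :+ b₅) :* x) :- t :=
        ((a₄ :+ b₄ :* (con 0ℚ :+ (x :+ con 0ℚ))) :+
          ((a₅ :+ b₅ :* (con 0ℚ :+ (x :+ con 0ℚ))) :+ con 0ℚ)) :- t)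
        refl (seq α₄ n) (seq α₅ n) (seq β₄ n) (seq β₅ n) (seq x₂ n) (seq (time e) n)

    -- The two path times agree, and `β₄₅` times the total flow eliminates `x₂`. The common time
    -- occurs on both sides and cancels.
    βx₁ : β * x₁ ≈ Q * β₄₅ + α
    βx₁ = ≈-combination (*-congˡ β₄₅ x₁+x₂ +-cong time-P₁ +-cong ≈-sym time-P₂) λ n →
      solve 10 (λ b₁ b₂ b₄ b₅ a₁₂ a₄₅ x₁ x₂ q t →
        (b₁ :+ b₂ :+ b₄ :+ b₅) :* x₁ :- (q :* (b₄ :+ b₅) :+ (a₄₅ :- a₁₂)) :=
        ((b₄ :+ b₅) :* (x₁ :+ x₂) :+ (a₁₂ :+ (b₁ :+ b₂) :* x₁) :+ t)
        :- ((b₄ :+ b₅) :* q :+ t :+ (a₄₅ :+ (b₄ :+ b₅) :* x₂)))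
        refl (seq β₁ n) (seq β₂ n) (seq β₄ n) (seq β₅ n)
        (seq (α₁ + α₂) n) (seq (α₄ + α₅) n)
        (seq x₁ n) (seq x₂ n) (seq Q n) (seq (time e) n)

    βx₂ : β * x₂ ≈ Q * β₁₂ - α
    βx₂ = ≈-combination (*-congˡ β₁₂ x₁+x₂ +-cong time-P₂ +-cong ≈-sym time-P₁) λ n →
      solve 10 (λ b₁ b₂ b₄ b₅ a₁₂ a₄₅ x₁ x₂ q t →
        (b₁ :+ b₂ :+ b₄ :+ b₅) :* x₂ :- (q :* (b₁ :+ b₂) :- (a₄₅ :- a₁₂)) :=
        ((b₁ :+ b₂) :* (x₁ :+ x₂) :+ (a₄₅ :+ (b₄ :+ b₅) :* x₂) :+ t)
        :- ((b₁ :+ b₂) :* q :+ t :+ (a₁₂ :+ (b₁ :+ b₂) :* x₁)))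
        refl (seq β₁ n) (seq β₂ n) (seq β₄ n) (seq β₅ n)
        (seq (α₁ + α₂) n) (seq (α₄ + α₅) n)
        (seq x₁ n) (seq x₂ n) (seq Q n) (seq (time e) n)

  -- Equilibrium of `N⁺` with `P₂` empty.

  module Augmented (e⁺ : Equilibrium π N⁺ Q) (only : OnlyVanishing (flow e⁺) P₂) where
    y₁ = amount (flow e⁺) P₁
    y₂ = amount (flow e⁺) P₂
    y₃ = amount (flow e⁺) P₃

    y₂≈0 : y₂ ≈ 0ℝ
    y₂≈0 = proj₁ only

    P₁-used : NonVanishing (flow e⁺) P₁
    P₁-used = proj₂ only P₁ λ ()

    P₃-used : NonVanishing (flow e⁺) P₃
    P₃-used = proj₂ only P₃ λ ()

    y₃>0 : 0ℝ < y₃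
    y₃>0 = nonneg∧#0⇒pos (nonNegative (flow e⁺) P₃) P₃-used

    y₁>0 : 0ℝ < y₁
    y₁>0 = nonneg∧#0⇒pos (nonNegative (flow e⁺) P₁) P₁-used

    y₁+y₃ : y₁ + y₃ ≈ Q
    y₁+y₃ = ≈-combination (total (flow e⁺) +-cong ≈-sym y₂≈0) λ n →
      solve 4 (λ x y z q → (x :+ z) :- q :=
        ((x :+ (y :+ (z :+ con 0ℚ))) :+ con 0ℚ) :- (q :+ y))
        refl (seq y₁ n) (seq y₂ n) (seq y₃ n) (seq Q n)

    -- Both used paths start with the link `ab`, which therefore carries all of `Q`.
    time-P₁ : α₁ + α₂ + β₁ * Q + β₂ * y₁ ≈ time e⁺
    time-P₁ = ≈-combination
      (nonVanishing e⁺ P₁ P₁-used +-cong *-congˡ β₁ (≈-sym y₁+y₃)) λ n →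
      solve 8 (λ a₁ a₂ b₁ b₂ x z q t →
        (a₁ :+ a₂ :+ b₁ :* q :+ b₂ :* x) :- t :=
        (((a₁ :+ b₁ :* (x :+ (con 0ℚ :+ (z :+ con 0ℚ)))) :+
          ((a₂ :+ b₂ :* (x :+ (con 0ℚ :+ (con 0ℚ :+ con 0ℚ)))) :+ con 0ℚ)) :+ b₁ :* q)
        :- (t :+ b₁ :* (x :+ z)))
        refl (seq α₁ n) (seq α₂ n) (seq β₁ n) (seq β₂ n)
        (seq y₁ n) (seq y₃ n) (seq Q n) (seq (time e⁺) n)

    time-P₃ : α₁ + α₃ + α₅ + β₁ * Q + β₃₅ * y₃ ≈ time e⁺
    time-P₃ = ≈-combination
      (nonVanishing e⁺ P₃ P₃-used +-cong *-congˡ β₁ (≈-sym y₁+y₃)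
        -- The link `cd` carries `y₂ + y₃`, and `y₂` is only `≈ 0ℝ`, so its contribution is removed
        -- by an explicit equation.
        +-cong *-congˡ β₅ (≈-sym y₂≈0)) λ n →
      solve 11 (λ a₁ a₃ a₅ b₁ b₃ b₅ x y z q t →
        (a₁ :+ a₃ :+ a₅ :+ b₁ :* q :+ (b₃ :+ b₅) :* z) :- t :=
        (((a₁ :+ b₁ :* (x :+ (con 0ℚ :+ (z :+ con 0ℚ)))) :+
          ((a₃ :+ b₃ :* (con 0ℚ :+ (con 0ℚ :+ (z :+ con 0ℚ)))) :+
          ((a₅ :+ b₅ :* (con 0ℚ :+ (y :+ (z :+ con 0ℚ)))) :+ con 0ℚ))) :+ b₁ :* q
          :+ b₅ :* con 0ℚ)
        :- (t :+ b₁ :* (x :+ z) :+ b₅ :* y))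
        refl (seq α₁ n) (seq α₃ n) (seq α₅ n) (seq β₁ n) (seq β₃ n) (seq β₅ n)
        (seq y₁ n) (seq y₂ n) (seq y₃ n) (seq Q n) (seq (time e⁺) n)

    -- The travel time of `P₂` differs from the right side by `β₄₅ * y₂`, which is `≈ 0ℝ`.
    time≤time-P₂ : time e⁺ ≤ α₄ + α₅ + β₅ * y₃
    time≤time-P₂ t₂<t = vanishing e⁺ P₂ y₂≈0
      (<-combination t₂<t (*-congˡ β₄₅ (≈-sym y₂≈0)) λ n →
      solve 7 (λ a₄ a₅ b₄ b₅ y z t →
        t :- ((a₄ :+ b₄ :* (con 0ℚ :+ (y :+ (con 0ℚ :+ con 0ℚ)))) :+
          ((a₅ :+ b₅ :* (con 0ℚ :+ (y :+ (z :+ con 0ℚ)))) :+ con 0ℚ)) :=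
        (t :- (a₄ :+ a₅ :+ b₅ :* z)) :+ ((b₄ :+ b₅) :* con 0ℚ :- (b₄ :+ b₅) :* y))
        refl (seq α₄ n) (seq α₅ n) (seq β₄ n) (seq β₅ n)
        (seq y₂ n) (seq y₃ n) (seq (time e⁺) n))

    -- The times of `P₁` and `P₃` agree, and `β₃₅` times the total flow eliminates `y₃`.
    β₂₃₅y₁ : β₂₃₅ * y₁ ≈ Q * β₃₅ - α̂
    β₂₃₅y₁ = ≈-combination (*-congˡ β₃₅ y₁+y₃ +-cong time-P₁ +-cong ≈-sym time-P₃) λ n →
      solve 12 (λ a₁ a₂ a₃ a₅ b₁ b₂ b₃ b₅ y₁ y₃ q t →
        (b₂ :+ b₃ :+ b₅) :* y₁ :- (q :* (b₃ :+ b₅) :- (a₂ :- (a₃ :+ a₅))) :=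
        ((b₃ :+ b₅) :* (y₁ :+ y₃) :+ (a₁ :+ a₂ :+ b₁ :* q :+ b₂ :* y₁) :+ t)
        :- ((b₃ :+ b₅) :* q :+ t :+ (a₁ :+ a₃ :+ a₅ :+ b₁ :* q :+ (b₃ :+ b₅) :* y₃)))
        refl (seq α₁ n) (seq α₂ n) (seq α₃ n) (seq α₅ n)
        (seq β₁ n) (seq β₂ n) (seq β₃ n) (seq β₅ n)
        (seq y₁ n) (seq y₃ n) (seq Q n) (seq (time e⁺) n)

    β₂₃₅y₃ : β₂₃₅ * y₃ ≈ Q * β₂ + α̂
    β₂₃₅y₃ = ≈-combination (*-congˡ β₂ y₁+y₃ +-cong time-P₃ +-cong ≈-sym time-P₁) λ n →
      solve 12 (λ a₁ a₂ a₃ a₅ b₁ b₂ b₃ b₅ y₁ y₃ q t →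
        (b₂ :+ b₃ :+ b₅) :* y₃ :- (q :* b₂ :+ (a₂ :- (a₃ :+ a₅))) :=
        (b₂ :* (y₁ :+ y₃) :+ (a₁ :+ a₃ :+ a₅ :+ b₁ :* q :+ (b₃ :+ b₅) :* y₃) :+ t)
        :- (b₂ :* q :+ t :+ (a₁ :+ a₂ :+ b₁ :* q :+ b₂ :* y₁)))
        refl (seq α₁ n) (seq α₂ n) (seq α₃ n) (seq α₅ n)
        (seq β₁ n) (seq β₂ n) (seq β₃ n) (seq β₅ n)
        (seq y₁ n) (seq y₃ n) (seq Q n) (seq (time e⁺) n)

    β₂₃₅>0 : 0ℝ < β₂₃₅
    β₂₃₅>0 = +-positive (+-positive (βᵢ>0 1F) (βᵢ>0 2F)) (βᵢ>0 4F)

    -- β₂₃₅ times the excess of time over the travel time of P₂ is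
    -- Q (β₁β₂₅ + β₃β₁₂) − (ᾱβ₂₅ + αβ₃).
    Q≤μ₂ : Q ≤ μ₂
    Q≤μ₂ μ₂<Q = time≤time-P₂ (0<y-x⇒x<y
      (0<x∧0<xy⇒0<y {β₂₃₅} {time e⁺ - (α₄ + α₅ + β₅ * y₃)} β₂₃₅>0
        (<-combination (/<⇒<* denominator>0 μ₂<Q)
          (*-congˡ β₂₃₅ (≈-sym time-P₃) +-cong *-congˡ β₃ β₂₃₅y₃) λ n →
          solve 13 (λ a₁ a₂ a₃ a₄ a₅ b₁ b₂ b₃ b₄ b₅ y₃ q t →
            (b₂ :+ b₃ :+ b₅) :* (t :- (a₄ :+ a₅ :+ b₅ :* y₃)) :- con 0ℚ :=
            (q :* (b₁ :* (b₂ :+ b₅) :+ b₃ :* (b₁ :+ b₂)) :-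
              ((a₄ :- (a₁ :+ a₃)) :* (b₂ :+ b₅) :+ ((a₄ :+ a₅) :- (a₁ :+ a₂)) :* b₃)) :+
            (((b₂ :+ b₃ :+ b₅) :* t :+ b₃ :* ((b₂ :+ b₃ :+ b₅) :* y₃)) :-
             ((b₂ :+ b₃ :+ b₅) :* (a₁ :+ a₃ :+ a₅ :+ b₁ :* q :+ (b₃ :+ b₅) :* y₃)
              :+ b₃ :* (q :* b₂ :+ (a₂ :- (a₃ :+ a₅))))))
            refl (seq α₁ n) (seq α₂ n) (seq α₃ n) (seq α₄ n) (seq α₅ n)
            (seq β₁ n) (seq β₂ n) (seq β₃ n) (seq β₄ n) (seq β₅ n)
            (seq y₃ n) (seq Q n) (seq (time e⁺) n))))

  -- Comparison of the two equilibrium times.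

  module Comparison
    (e : Equilibrium π N Q) (e⁺ : Equilibrium π N⁺ Q)
    (used : ∀ p → NonVanishing (flow e) p) (only : OnlyVanishing (flow e⁺) P₂) where
    open Original e used hiding (time-P₁; time-P₂)
    open Augmented e⁺ only hiding (time-P₁; time-P₃)
    module Old = Original e used
    module New = Augmented e⁺ only

    Δ : ℝ
    Δ = time e⁺ - time e

    c : ℝ
    c = α̂ * β₂ * β + α * β₂₃₅ * β₁₂

    β>0 : 0ℝ < β
    β>0 = +-positive (+-positive β₁₂>0 (βᵢ>0 3F)) (βᵢ>0 4F)

    -- Reading both times along `P₁` gives `Δ = β₁Q + β₂y₁ - β₁₂x₁`. Multiplying by `β * β₂₃₅` makes
    -- room for the formulas for `y₁` and `x₁`.
    ββ₂₃₅Δ : β * β₂₃₅ * Δ ≈ Q * ℬ₄ - c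
    ββ₂₃₅Δ = ≈-combination
      (*-congˡ (β * β₂₃₅) (≈-sym New.time-P₁ +-cong Old.time-P₁)
        +-cong *-congˡ (β₂ * β) β₂₃₅y₁
        +-cong *-congˡ (β₁₂ * β₂₃₅) (≈-sym βx₁)) λ n →
      solve 13 (λ a₁₂ a a^ b₁ b₂ b₃ b₄ b₅ q x y t t⁺ → let
          b = b₁ :+ b₂ :+ b₄ :+ b₅ ; b₂₃₅ = b₂ :+ b₃ :+ b₅ ; b₁₂ = b₁ :+ b₂ in
        b :* b₂₃₅ :* (t⁺ :- t) :-
          (q :* (b₁₂ :* b₁₂ :* b₂₃₅ :- b₂ :* b₂ :* b) :-
            (a^ :* b₂ :* b :+ a :* b₂₃₅ :* b₁₂)) :=
        (b :* b₂₃₅ :* (t⁺ :+ (a₁₂ :+ b₁₂ :* x)) :+ b₂ :* b :* (b₂₃₅ :* y)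
          :+ b₁₂ :* b₂₃₅ :* (q :* (b₄ :+ b₅) :+ a)) :-
        (b :* b₂₃₅ :* ((a₁₂ :+ b₁ :* q :+ b₂ :* y) :+ t)
          :+ b₂ :* b :* (q :* (b₃ :+ b₅) :- a^)
          :+ b₁₂ :* b₂₃₅ :* (b :* x)))
        refl (seq (α₁ + α₂) n) (seq α n) (seq α̂ n)
        (seq β₁ n) (seq β₂ n) (seq β₃ n) (seq β₄ n) (seq β₅ n)
        (seq Q n) (seq x₁ n) (seq y₁ n) (seq (time e) n) (seq (time e⁺) n)

    braess⇒c<Qℬ₄ : time e < time e⁺ → c < Q * ℬ₄
    braess⇒c<Qℬ₄ t<t⁺ = <-combination
      (*-positive (*-positive β>0 β₂₃₅>0)
        (x<y⇒0<y-x t<t⁺))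
      (≈-sym ββ₂₃₅Δ) λ n →
      solve 3 (λ q c z → q :- c := (z :- con 0ℚ) :+ ((q :- c) :- z))
        refl (seq (Q * ℬ₄) n) (seq c n) (seq (β * β₂₃₅ * Δ) n)

    c<Qℬ₄⇒braess : c < Q * ℬ₄ → time e < time e⁺
    c<Qℬ₄⇒braess c<Qℬ₄ = 0<y-x⇒x<y
      (0<x∧0<xy⇒0<y {β * β₂₃₅} {Δ} (*-positive β>0 β₂₃₅>0)
        (<-combination c<Qℬ₄ ββ₂₃₅Δ λ n →
          solve 3 (λ q c z → z :- con 0ℚ := (q :- c) :+ (z :- (q :- c)))
            refl (seq (Q * ℬ₄) n) (seq c n) (seq (β * β₂₃₅ * Δ) n)))

    -- Comparing the two networks along P₁ gives β₁₂x₂ − β₂y₃ = Δ, and along P₂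
    -- β₅y₃ − β₄₅x₂ ≥ Δ.  Eliminating x₂ gives β₁₂β₅ > β₂β₄₅.
    braess⇒ℬ₄>0 : time e < time e⁺ → 0ℝ < ℬ₄
    braess⇒ℬ₄>0 t<t⁺ = <-resp-difference
      (+-positive (+-positive (+-positive
        (*-positive β₁₂>0 D>0)
        (*-positive (*-positive β₁₂>0 β₁₂>0) (βᵢ>0 2F)))
        (*-positive (*-positive β₁₂>0 (βᵢ>0 1F)) (βᵢ>0 0F)))
        (*-positive (*-positive (βᵢ>0 0F) (βᵢ>0 1F)) β₄₅>0))
      λ n → solve 5 (λ b₁ b₂ b₃ b₄ b₅ → let b₁₂ = b₁ :+ b₂ ; b₄₅ = b₄ :+ b₅ in
        (b₁₂ :* b₁₂ :* (b₂ :+ b₃ :+ b₅) :- b₂ :* b₂ :* (b₁ :+ b₂ :+ b₄ :+ b₅)) :- con 0ℚ :=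
        (b₁₂ :* (b₁₂ :* b₅ :- b₂ :* b₄₅) :+ b₁₂ :* b₁₂ :* b₃ :+ b₁₂ :* b₂ :* b₁
          :+ b₁ :* b₂ :* b₄₅) :- con 0ℚ)
        refl (seq β₁ n) (seq β₂ n) (seq β₃ n) (seq β₄ n) (seq β₅ n)
      where
      D : ℝ
      D = β₁₂ * β₅ - β₂ * β₄₅

      β₄₅x₂<β₅y₃ : β₄₅ * x₂ < β₅ * y₃
      β₄₅x₂<β₅y₃ = <-combination (<-≤-trans t<t⁺ time≤time-P₂) (≈-sym Old.time-P₂) λ n →
        solve 4 (λ t a x y → y :- x := ((a :+ y) :- t) :+ (t :- (a :+ x)))
          refl (seq (time e) n) (seq (α₄ + α₅) n) (seq (β₄₅ * x₂) n) (seq (β₅ * y₃) n)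

      β₂y₃<β₁₂x₂ : β₂ * y₃ < β₁₂ * x₂
      β₂y₃<β₁₂x₂ = <-combination t<t⁺
        -- Replacing `x₁` by `Q - x₂` and `y₁` by `Q - y₃` turns `β₁Q + β₂y₁ - β₁₂x₁` into
        -- `β₁₂x₂ - β₂y₃`.
        (New.time-P₁ +-cong ≈-sym Old.time-P₁
          +-cong *-congˡ β₁₂ x₁+x₂ +-cong *-congˡ β₂ (≈-sym y₁+y₃)) λ n →
        solve 10 (λ a₁₂ b₁ b₂ x₁ x₂ y₁ y₃ q t t⁺ →
          (b₁ :+ b₂) :* x₂ :- b₂ :* y₃ :=
          (t⁺ :- t) :+
          (((a₁₂ :+ b₁ :* q :+ b₂ :* y₁) :+ t :+ (b₁ :+ b₂) :* (x₁ :+ x₂) :+ b₂ :* q) :-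
           (t⁺ :+ (a₁₂ :+ (b₁ :+ b₂) :* x₁) :+ (b₁ :+ b₂) :* q :+ b₂ :* (y₁ :+ y₃))))
          refl (seq (α₁ + α₂) n) (seq β₁ n) (seq β₂ n) (seq x₁ n) (seq x₂ n)
          (seq y₁ n) (seq y₃ n) (seq Q n) (seq (time e) n) (seq (time e⁺) n)

      D>0 : 0ℝ < D
      -- With weights `β₁₂` and `β₄₅` the two differences add up to `y₃ * D`, and `y₃ > 0` divides
      -- out.
      D>0 = 0<x∧0<xy⇒0<y {y₃} {D} y₃>0 (<-resp-difference
        (+-positive
          (*-positive β₁₂>0 (x<y⇒0<y-x β₄₅x₂<β₅y₃))
          (*-positive β₄₅>0 (x<y⇒0<y-x β₂y₃<β₁₂x₂)))
        λ n → solve 6 (λ b₁₂ b₂ b₅ b₄₅ x y →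
          y :* (b₁₂ :* b₅ :- b₂ :* b₄₅) :- con 0ℚ :=
          (b₁₂ :* (b₅ :* y :- b₄₅ :* x) :+ b₄₅ :* (b₁₂ :* x :- b₂ :* y)) :- con 0ℚ)
          refl (seq β₁₂ n) (seq β₂ n) (seq β₅ n) (seq β₄₅ n) (seq x₂ n) (seq y₃ n))

    -- The part of the maximum free of `ℬ₄`. As `⊔` associates to the left,
    -- `lower ⊔ c / ℬ₄ [ ℬ₄>0 ]` unfolds to the maximum in the theorem.
    lower : ℝ
    lower = (α / β₁₂ [ β₁₂>0 ]) ⊔ ((- α) / β₄₅ [ β₄₅>0 ])
          ⊔ (α̂ / β₃₅ [ β₃₅>0 ]) ⊔ ((- α̂) / β₂ [ β₂>0 ])

    -- Holds with or without a paradox: the four bounds are, in order, the positivity of `x₂`, `x₁`,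
    -- `y₁` and `y₃`.
    lower<Q : lower < Q
    lower<Q = ⊔-<⁺ {(α / β₁₂ [ β₁₂>0 ]) ⊔ ((- α) / β₄₅ [ β₄₅>0 ]) ⊔ (α̂ / β₃₅ [ β₃₅>0 ])}
        {(- α̂) / β₂ [ β₂>0 ]}
      (⊔-<⁺ {(α / β₁₂ [ β₁₂>0 ]) ⊔ ((- α) / β₄₅ [ β₄₅>0 ])} {α̂ / β₃₅ [ β₃₅>0 ]}
      (⊔-<⁺ {α / β₁₂ [ β₁₂>0 ]} {(- α) / β₄₅ [ β₄₅>0 ]}
        (<*⇒/< β₁₂>0 (positive⇒< β>0 x₂>0 βx₂ λ n → refl))
        (<*⇒/< β₄₅>0 (positive⇒< β>0 x₁>0 βx₁ λ n →
          solve 2 (λ p a → p :- (:- a) := p :+ a) refl (seq (Q * β₄₅) n) (seq α n))))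
        (<*⇒/< β₃₅>0 (positive⇒< β₂₃₅>0 y₁>0 β₂₃₅y₁ λ n → refl)))
        (<*⇒/< β₂>0 (positive⇒< β₂₃₅>0 y₃>0 β₂₃₅y₃ λ n →
          solve 2 (λ p a → p :- (:- a) := p :+ a) refl (seq (Q * β₂) n) (seq α̂ n)))

    -- Positivity of `ℬ₄` comes first because the quotient in the maximum takes its proof as an
    -- argument.
    braess⇒bounds : time e < time e⁺ →
      Σ (0ℝ < ℬ₄) λ ℬ₄>0 → (lower ⊔ c / ℬ₄ [ ℬ₄>0 ] < Q) × (Q ≤ μ₂)
    braess⇒bounds braess = ℬ₄>0 , bound-c , Q≤μ₂
      where
      ℬ₄>0 : 0ℝ < ℬ₄
      ℬ₄>0 = braess⇒ℬ₄>0 braess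

      bound-c : lower ⊔ c / ℬ₄ [ ℬ₄>0 ] < Q
      bound-c = ⊔-<⁺ {lower} {c / ℬ₄ [ ℬ₄>0 ]} lower<Q
        (<*⇒/< {c} {ℬ₄} {Q} ℬ₄>0 (braess⇒c<Qℬ₄ braess))

    bounds⇒braess : (Σ (0ℝ < ℬ₄) λ ℬ₄>0 → (lower ⊔ c / ℬ₄ [ ℬ₄>0 ] < Q) × (Q ≤ μ₂)) →
      time e < time e⁺
    bounds⇒braess (ℬ₄>0 , max<Q , _) = c<Qℬ₄⇒braess
      (/<⇒<* {c} {ℬ₄} {Q} ℬ₄>0 (⊔-<⁻ʳ {lower} {c / ℬ₄ [ ℬ₄>0 ]} {Q} max<Q))

theorem4 : (π : Parameters) (Q : ℝ) → 0ℝ < Q →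
    (e : Equilibrium π N Q) (e⁺ : Equilibrium π N⁺ Q) →
    (∀ p → NonVanishing (flow e) p) →
    OnlyVanishing (flow e⁺) P₂ →
    let open Quantities π in
    BraessParadox e e⁺ ⇔
    Σ (0ℝ < ℬ₄) λ ℬ₄>0 →
    ( (α / β₁₂ [ β₁₂>0 ])
    ⊔ ((- α) / β₄₅ [ β₄₅>0 ])
    ⊔ (α̂ / β₃₅ [ β₃₅>0 ])
    ⊔ ((- α̂) / β₂ [ β₂>0 ])
    ⊔ ((α̂ * β₂ * β + α * β₂₃₅ * β₁₂) / ℬ₄ [ ℬ₄>0 ])
    < Q )
    × (Q ≤ μ₂)
theorem4 π Q _ e e⁺ used only = mk⇔ braess⇒bounds bounds⇒braess
  where open Comparison π Q e e⁺ used only
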